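{- Let $\Omega$ be a topological signature and $A$ a Stone topological $\Omega$-algebra. Then $A$ is profinite if and only if, for every clopen subset $L$ of $A$, the syntactic congruence $\sigma_L^A$ is a clopen subset of $A\times A$.
   Context: A topological $\Omega$-algebra is a topological space $A$ with continuous evaluation maps $E_n^A:\Omega_n\times A^n\to A$, where $\Omega=\biguplus_n\Omega_n$ is a signature of topological spaces. A Stone topological algebra is one whose underlying space is compact (Hausdorff) and 0-dimensional. $A$ is profinite if it is compact and for any two distinct elements there is a continuous homomorphism into a finite discrete $\Omega$-algebra separating them. For $L\subseteq A$, the syntactic congruence $\sigma_L^A$ is the largest congruence on $A$ saturating $L$ (i.e., such that $L$ is a union of its classes); equivalently, $(a,a')\in\sigma_L^A$ iff for every translation $f$ of $A$, $f(a)\in L\iff f(a')\in L$, where a translation is a map $a\mapsto t_A(a_1,\dots,a_{i-1},a,a_{i+1},\dots,a_m)$ given by a term $t$ in which the variable $x_i$ occurs exactly once and fixed $a_j\in A$. -}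

module Defs where

open import Data.Fin using (Fin; zero; suc; _≟_; _↑ˡ_; _↑ʳ_)
open import Data.Fin.Properties using (↑ʳ-injective; suc-injective; 0≢1+n)
open import Data.List using (List)
open import Data.List.Relation.Unary.Any using (Any)
open import Data.Nat using (ℕ; zero; suc; _+_)
open import Data.Product using (Σ; Σ-syntax; ∃; ∃-syntax; _×_; _,_; proj₁; proj₂; uncurry)
open import Data.Unit.Polymorphic using (tt)
open import Data.Vec using (Vec; []; _∷_; lookup; map; insertAt; removeAt; tabulate; _++_; _[_]≔_)
open import Data.Vec.Properties using (lookup∘tabulate; tabulate∘lookup; tabulate-cong; lookup-++ˡ; lookup-++ʳ; insertAt-lookup)
open import Data.Vec.Relation.Binary.Pointwise.Inductive using (Pointwise; []; _∷_)
open import Function using (_∘_; _⇔_; mk⇔; _↔_; Equivalence; id)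
open import Level using (Level) renaming (suc to lsuc)
open import Relation.Binary using (Rel; IsEquivalence; _⇒_)
open import Relation.Binary.PropositionalEquality using (_≡_; _≢_; refl; sym; trans; cong; cong₂; subst₂; module ≡-Reasoning)
open import Relation.Nullary using (¬_; yes; no; contradiction)
open import Relation.Unary using (Pred; _∈_; _∩_; _⊆_; _≐_; ∁; ⋃; _⊢_)
open import Relation.Unary.Polymorphic using (U)

-- A subset is a predicate, so the family of open sets has to respect
-- extensional equality of predicates.  That the empty set is open is the
-- instance of `open-⋃` at an empty index type.
record Space (ℓ : Level) : Set (lsuc (lsuc ℓ)) where
  field
    Carrier : Set ℓ
    IsOpen  : Pred Carrier ℓ → Set (lsuc ℓ)
    open-≐  : ∀ {V W} → V ≐ W → IsOpen V → IsOpen W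
    open-U  : IsOpen U
    open-∩  : ∀ {V W} → IsOpen V → IsOpen W → IsOpen (V ∩ W)
    open-⋃  : ∀ (I : Set ℓ) (V : I → Pred Carrier ℓ) →
              (∀ i → IsOpen (V i)) → IsOpen (⋃ I V)

open Space using (Carrier; IsOpen)

module _ {ℓ : Level} where

  Continuous : (X Y : Space ℓ) → (Carrier X → Carrier Y) → Set (lsuc ℓ)
  Continuous X Y f = ∀ V → IsOpen Y V → IsOpen X (f ⊢ V)

  IsClosed : (X : Space ℓ) → Pred (Carrier X) ℓ → Set (lsuc ℓ)
  IsClosed X V = IsOpen X (∁ V)

  IsClopen : (X : Space ℓ) → Pred (Carrier X) ℓ → Set (lsuc ℓ)
  IsClopen X V = IsOpen X V × IsClosed X V

  IsHausdorff : Space ℓ → Set (lsuc ℓ)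
  IsHausdorff X = ∀ x y → x ≢ y →
    ∃[ V ] ∃[ W ] IsOpen X V × IsOpen X W × x ∈ V × y ∈ W ×
      (∀ z → ¬ z ∈ (V ∩ W))

  HasFiniteSubcovers : Space ℓ → Set (lsuc ℓ)
  HasFiniteSubcovers X = ∀ (I : Set ℓ) (V : I → Pred (Carrier X) ℓ) →
    (∀ i → IsOpen X (V i)) → (∀ x → x ∈ ⋃ I V) →
    Σ[ is ∈ List I ] (∀ x → Any (λ i → x ∈ V i) is)

  -- Compact spaces are Hausdorff by convention.
  IsCompact : Space ℓ → Set (lsuc ℓ)
  IsCompact X = HasFiniteSubcovers X × IsHausdorff X

  -- The clopen sets form a basis of the topology.
  IsZeroDimensional : Space ℓ → Set (lsuc ℓ)
  IsZeroDimensional X = ∀ V → IsOpen X V → ∀ x → x ∈ V →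
    ∃[ W ] IsClopen X W × x ∈ W × W ⊆ V

  IsStone : Space ℓ → Set (lsuc ℓ)
  IsStone X = IsCompact X × IsZeroDimensional X

  IsDiscrete : Space ℓ → Set (lsuc ℓ)
  IsDiscrete X = ∀ V → IsOpen X V

  IsFinite : Set ℓ → Set ℓ
  IsFinite S = ∃[ n ] (S ↔ Fin n)

  infixr 2 _×ₛ_
  infix  8 _^ₛ_

  _×ₛ_ : Space ℓ → Space ℓ → Space ℓ
  X ×ₛ Y = record
    { Carrier = Carrier X × Carrier Y
    ; IsOpen  = λ W → ∀ x y → (x , y) ∈ W →
        ∃[ V₁ ] ∃[ V₂ ] IsOpen X V₁ × IsOpen Y V₂ × x ∈ V₁ × y ∈ V₂ ×
          (∀ x′ y′ → x′ ∈ V₁ → y′ ∈ V₂ → (x′ , y′) ∈ W)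
    ; open-≐  = λ (V⊆W , W⊆V) o x y xy∈W →
        let V₁ , V₂ , o₁ , o₂ , x∈ , y∈ , sub = o x y (W⊆V xy∈W) in
        V₁ , V₂ , o₁ , o₂ , x∈ , y∈ , λ x′ y′ p q → V⊆W (sub x′ y′ p q)
    ; open-U  = λ _ _ _ → U , U , Space.open-U X , Space.open-U Y , tt , tt , λ _ _ _ _ → tt
    ; open-∩  = λ o o′ x y (p , p′) →
        let V₁ , V₂ , o₁ , o₂ , x∈ , y∈ , sub = o x y p
            V₁′ , V₂′ , o₁′ , o₂′ , x∈′ , y∈′ , sub′ = o′ x y p′ in
        V₁ ∩ V₁′ , V₂ ∩ V₂′ , Space.open-∩ X o₁ o₁′ , Space.open-∩ Y o₂ o₂′ ,
        (x∈ , x∈′) , (y∈ , y∈′) ,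
        λ x′ y′ (q₁ , q₁′) (q₂ , q₂′) → sub x′ y′ q₁ q₂ , sub′ x′ y′ q₁′ q₂′
    ; open-⋃  = λ I V o x y (i , p) →
        let V₁ , V₂ , o₁ , o₂ , x∈ , y∈ , sub = o i x y p in
        V₁ , V₂ , o₁ , o₂ , x∈ , y∈ , λ x′ y′ q₁ q₂ → i , sub x′ y′ q₁ q₂
    }

  _^ₛ_ : Space ℓ → ℕ → Space ℓ
  X ^ₛ n = record
    { Carrier = Vec (Carrier X) n
    ; IsOpen  = λ W → ∀ v → v ∈ W →
        Σ[ V ∈ (Fin n → Pred (Carrier X) ℓ) ]
          (∀ i → IsOpen X (V i)) × (∀ i → lookup v i ∈ V i) ×
          (∀ w → (∀ i → lookup w i ∈ V i) → w ∈ W)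
    ; open-≐  = λ (V⊆W , W⊆V) o v v∈W →
        let B , oB , v∈ , sub = o v (W⊆V v∈W) in
        B , oB , v∈ , λ w p → V⊆W (sub w p)
    ; open-U  = λ _ _ → (λ _ → U) , (λ _ → Space.open-U X) , (λ _ → tt) , λ _ _ → tt
    ; open-∩  = λ o o′ v (p , p′) →
        let B , oB , v∈ , sub = o v p
            B′ , oB′ , v∈′ , sub′ = o′ v p′ in
        (λ i → B i ∩ B′ i) , (λ i → Space.open-∩ X (oB i) (oB′ i)) ,
        (λ i → v∈ i , v∈′ i) ,
        λ w q → sub w (proj₁ ∘ q) , sub′ w (proj₂ ∘ q)
    ; open-⋃  = λ I V o v (i , p) →
        let B , oB , v∈ , sub = o i v p in
        B , oB , v∈ , λ w q → i , sub w q
    }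

-- `Ω n` is the space of n-ary operation symbols.
Signature : (ℓ : Level) → Set (lsuc (lsuc ℓ))
Signature ℓ = ℕ → Space ℓ

record TopAlgebra {ℓ : Level} (Ω : Signature ℓ) : Set (lsuc (lsuc ℓ)) where
  field
    space   : Space ℓ
    E       : ∀ n → Carrier (Ω n) → Vec (Carrier space) n → Carrier space
    E-cont  : ∀ n → Continuous (Ω n ×ₛ space ^ₛ n) space (uncurry (E n))

  ∣_∣ : Set ℓ
  ∣_∣ = Carrier space

open TopAlgebra using (space; E; ∣_∣)

-- S picks representatives of the θ-classes whose union is L.
Saturates : {ℓ : Level} {X : Set ℓ} → Rel X ℓ → Pred X ℓ → Set (lsuc ℓ)
Saturates {ℓ} {X} θ L = Σ[ S ∈ Pred X ℓ ] L ≐ ⋃ (∃ S) (λ (s , _) → θ s)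

module _ {ℓ : Level} {Ω : Signature ℓ} where

  IsHomomorphism : (A B : TopAlgebra Ω) → (∣ A ∣ → ∣ B ∣) → Set ℓ
  IsHomomorphism A B h = ∀ n ω v → h (E A n ω v) ≡ E B n ω (map h v)

  IsProfinite : TopAlgebra Ω → Set (lsuc (lsuc ℓ))
  IsProfinite A = IsCompact (space A) ×
    (∀ a b → a ≢ b →
      Σ[ F ∈ TopAlgebra Ω ] IsFinite ∣ F ∣ × IsDiscrete (space F) ×
      Σ[ h ∈ (∣ A ∣ → ∣ F ∣) ]
        IsHomomorphism A F h × Continuous (space A) (space F) h × h a ≢ h b)

  record IsCongruence (A : TopAlgebra Ω) (θ : Rel ∣ A ∣ ℓ) : Set ℓ where
    field
      isEquivalence : IsEquivalence θ
      compatible    : ∀ n ω {v w} → Pointwise θ {n} {n} v w →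
                      θ (E A n ω v) (E A n ω w)

  record IsLargestSaturatingCongruence
    (A : TopAlgebra Ω) (L : Pred ∣ A ∣ ℓ) (θ : Rel ∣ A ∣ ℓ) : Set (lsuc ℓ) where
    field
      isCongruence : IsCongruence A θ
      saturates    : Saturates θ L
      largest      : ∀ {θ′} → IsCongruence A θ′ → Saturates θ′ L → θ′ ⇒ θ

δ : ∀ {m} → Fin m → Fin m → ℕ
δ i j with i ≟ j
... | yes _ = 1
... | no  _ = 0

data Term {ℓ : Level} (Ω : Signature ℓ) (m : ℕ) : Set ℓ where
  var : Fin m → Term Ω m
  op  : ∀ {n} → Carrier (Ω n) → Vec (Term Ω m) n → Term Ω m

module _ {ℓ : Level} {Ω : Signature ℓ} where

  mutual
    occurrences : ∀ {m} → Fin m → Term Ω m → ℕ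
    occurrences i (var j)   = δ i j
    occurrences i (op _ ts) = occurrencesVec i ts

    occurrencesVec : ∀ {m n} → Fin m → Vec (Term Ω m) n → ℕ
    occurrencesVec i []       = 0
    occurrencesVec i (t ∷ ts) = occurrences i t + occurrencesVec i ts

  module _ (A : TopAlgebra Ω) where

    mutual
      eval : ∀ {m} → Term Ω m → Vec ∣ A ∣ m → ∣ A ∣
      eval (var i)       ρ = lookup ρ i
      eval (op {n} ω ts) ρ = E A n ω (evalVec ts ρ)

      evalVec : ∀ {m n} → Vec (Term Ω m) n → Vec ∣ A ∣ m → Vec ∣ A ∣ n
      evalVec []       ρ = []
      evalVec (t ∷ ts) ρ = eval t ρ ∷ evalVec ts ρ

    record Translation : Set ℓ where
      field
        {m}    : ℕ
        term   : Term Ω (suc m)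
        hole   : Fin (suc m)
        once   : occurrences hole term ≡ 1
        params : Vec ∣ A ∣ m

      ⟦_⟧ : ∣ A ∣ → ∣ A ∣
      ⟦_⟧ a = eval term (insertAt params hole a)

    open Translation public using (⟦_⟧)

    translationRelation : Pred ∣ A ∣ ℓ → Rel ∣ A ∣ ℓ
    translationRelation L a a′ =
      (f : Translation) → (⟦ f ⟧ a ∈ L) ⇔ (⟦ f ⟧ a′ ∈ L)

module Plug {ℓ : Level} {Ω : Signature ℓ} where

  mutual
    bind : ∀ {m k} → Term Ω m → (Fin m → Term Ω k) → Term Ω k
    bind (var i)   s = s i
    bind (op ω ts) s = op ω (bindVec ts s)

    bindVec : ∀ {m k n} → Vec (Term Ω m) n → (Fin m → Term Ω k) → Vec (Term Ω k) n
    bindVec []       s = []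
    bindVec (t ∷ ts) s = bind t s ∷ bindVec ts s

  δ-refl : ∀ {m} (i : Fin m) → δ i i ≡ 1
  δ-refl i with i ≟ i
  ... | yes _ = refl
  ... | no  p = contradiction refl p

  δ-≢ : ∀ {m} {i j : Fin m} → i ≢ j → δ i j ≡ 0
  δ-≢ {i = i} {j} i≢j with i ≟ j
  ... | yes p = contradiction p i≢j
  ... | no  _ = refl

  module _ {m k : ℕ} (s : Fin m → Term Ω k) (i : Fin m) (l : Fin k)
           (occ-s : ∀ j → occurrences l (s j) ≡ δ i j) where
    mutual
      occ-bind : ∀ t → occurrences l (bind t s) ≡ occurrences i t
      occ-bind (var j)   = occ-s j
      occ-bind (op ω ts) = occ-bindVec ts

      occ-bindVec : ∀ {n} (ts : Vec (Term Ω m) n) →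
                    occurrencesVec l (bindVec ts s) ≡ occurrencesVec i ts
      occ-bindVec []       = refl
      occ-bindVec (t ∷ ts) = cong₂ _+_ (occ-bind t) (occ-bindVec ts)

  vars : ∀ {n k} → (Fin n → Fin k) → Vec (Term Ω k) n
  vars f = tabulate (var ∘ f)

  occ-vars-∉ : ∀ {n k} (f : Fin n → Fin k) l → (∀ j → l ≢ f j) →
               occurrencesVec l (vars f) ≡ 0
  occ-vars-∉ {zero}  f l l∉ = refl
  occ-vars-∉ {suc n} f l l∉ =
    cong₂ _+_ (δ-≢ (l∉ zero)) (occ-vars-∉ (f ∘ suc) l (l∉ ∘ suc))

  occ-vars-∈ : ∀ {n k} (f : Fin n → Fin k) → (∀ {i j} → f i ≡ f j → i ≡ j) →
               ∀ j → occurrencesVec (f j) (vars f) ≡ 1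
  occ-vars-∈ f inj zero =
    cong₂ _+_ (δ-refl (f zero))
      (occ-vars-∉ (f ∘ suc) (f zero) λ j p → 0≢1+n (inj p))
  occ-vars-∈ f inj (suc j) =
    cong₂ _+_ (δ-≢ λ p → 0≢1+n (sym (inj p)))
      (occ-vars-∈ (f ∘ suc) (suc-injective ∘ inj) j)

  ↑ˡ≢↑ʳ : ∀ {m n} (i : Fin m) (j : Fin n) → m ↑ʳ j ≢ i ↑ˡ n
  ↑ˡ≢↑ʳ zero    j ()
  ↑ˡ≢↑ʳ (suc i) j p = ↑ˡ≢↑ʳ i j (suc-injective p)

  vec-ext : ∀ {n} {X : Set ℓ} {v w : Vec X n} →
            (∀ i → lookup v i ≡ lookup w i) → v ≡ w
  vec-ext {v = v} {w} p =
    trans (sym (tabulate∘lookup v)) (trans (tabulate-cong p) (tabulate∘lookup w))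

  insertAt-≢ : ∀ {n} {X : Set ℓ} (v : Vec X n) i {j} → i ≢ j → ∀ x y →
               lookup (insertAt v i x) j ≡ lookup (insertAt v i y) j
  insertAt-≢ v       zero    {zero}  p x y = contradiction refl p
  insertAt-≢ v       zero    {suc j} p x y = refl
  insertAt-≢ (_ ∷ v) (suc i) {zero}  p x y = refl
  insertAt-≢ (_ ∷ v) (suc i) {suc j} p x y = insertAt-≢ v i (p ∘ cong suc) x y

  insertAt-removeAt-≔ : ∀ {n} {X : Set ℓ} (v : Vec X (suc n)) i x →
                        insertAt (removeAt v i) i x ≡ v [ i ]≔ x
  insertAt-removeAt-≔ (_ ∷ v)         zero    x = refl
  insertAt-removeAt-≔ (y ∷ v@(_ ∷ _)) (suc i) x = cong (y ∷_) (insertAt-removeAt-≔ v i x)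

  ++-≔ : ∀ {m n} {X : Set ℓ} (u : Vec X m) (v : Vec X n) j x →
         (u ++ v) [ m ↑ʳ j ]≔ x ≡ u ++ (v [ j ]≔ x)
  ++-≔ []      v j x = refl
  ++-≔ (y ∷ u) v j x = cong (y ∷_) (++-≔ u v j x)

  module _ (A : TopAlgebra Ω) where

    mutual
      eval-bind : ∀ {m k} (t : Term Ω m) (s : Fin m → Term Ω k) ρ →
                  eval A (bind t s) ρ ≡ eval A t (tabulate λ j → eval A (s j) ρ)
      eval-bind (var i)       s ρ = sym (lookup∘tabulate _ i)
      eval-bind (op {n} ω ts) s ρ = cong (E A n ω) (eval-bindVec ts s ρ)

      eval-bindVec : ∀ {m k n} (ts : Vec (Term Ω m) n) (s : Fin m → Term Ω k) ρ →
                     evalVec A (bindVec ts s) ρ ≡ evalVec A ts (tabulate λ j → eval A (s j) ρ)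
      eval-bindVec []       s ρ = refl
      eval-bindVec (t ∷ ts) s ρ = cong₂ _∷_ (eval-bind t s ρ) (eval-bindVec ts s ρ)

    eval-vars : ∀ {n k} (f : Fin n → Fin k) ρ →
                evalVec A (vars f) ρ ≡ tabulate (lookup ρ ∘ f)
    eval-vars {zero}  f ρ = refl
    eval-vars {suc n} f ρ = cong (lookup ρ (f zero) ∷_) (eval-vars (f ∘ suc) ρ)

    -- The composite of a translation f with x ↦ E ω (v [ j ]≔ x): the hole of
    -- the term of f is replaced by ω applied to n fresh variables.
    module _ (f : Translation A) {n : ℕ} (ω : Carrier (Ω n)) (v : Vec ∣ A ∣ n) (j : Fin n) where
      open Translation f renaming (⟦_⟧ to ⟦f⟧)

      fresh : Fin n → Fin (suc m + n)
      fresh = suc m ↑ʳ_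

      s : Fin (suc m) → Term Ω (suc m + n)
      s l with hole ≟ l
      ... | yes _ = op ω (vars fresh)
      ... | no  _ = var (l ↑ˡ n)

      occ-s : ∀ l → occurrences (fresh j) (s l) ≡ δ hole l
      occ-s l with hole ≟ l
      ... | yes _ = occ-vars-∈ fresh (↑ʳ-injective (suc m) _ _) j
      ... | no  _ = δ-≢ (↑ˡ≢↑ʳ l j)

      env : Vec ∣ A ∣ (suc m + n)
      env = insertAt params hole (lookup v j) ++ v

      composite : Translation A
      composite = record
        { m      = m + n
        ; term   = bind term s
        ; hole   = fresh j
        ; once   = trans (occ-bind s hole (fresh j) occ-s term) once
        ; params = removeAt env (fresh j)
        }

      eval-s : ∀ x l →
        eval A (s l) (insertAt params hole (lookup v j) ++ (v [ j ]≔ x)) ≡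
        lookup (insertAt params hole (E A n ω (v [ j ]≔ x))) l
      eval-s x l with hole ≟ l
      ... | yes refl =
        trans (cong (E A n ω)
                (trans (eval-vars fresh (u ++ (v [ j ]≔ x)))
                  (vec-ext λ i → trans (lookup∘tabulate _ i) (lookup-++ʳ u (v [ j ]≔ x) i))))
              (sym (insertAt-lookup params hole _))
        where u = insertAt params hole (lookup v j)
      ... | no p =
        trans (lookup-++ˡ (insertAt params hole (lookup v j)) (v [ j ]≔ x) l)
              (insertAt-≢ params hole p _ _)

      composite-eval : ∀ x → ⟦ composite ⟧ x ≡ ⟦f⟧ (E A n ω (v [ j ]≔ x))
      composite-eval x = begin
        eval A (bind term s) (insertAt (removeAt env (fresh j)) (fresh j) x)
          ≡⟨ cong (eval A (bind term s))
               (trans (insertAt-removeAt-≔ env (fresh j) x) (++-≔ u v j x)) ⟩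
        eval A (bind term s) (u ++ (v [ j ]≔ x))
          ≡⟨ eval-bind term s (u ++ (v [ j ]≔ x)) ⟩
        eval A term (tabulate λ l → eval A (s l) (u ++ (v [ j ]≔ x)))
          ≡⟨ cong (eval A term) (vec-ext λ l → trans (lookup∘tabulate (λ l → eval A (s l) (u ++ (v [ j ]≔ x))) l) (eval-s x l)) ⟩
        ⟦f⟧ (E A n ω (v [ j ]≔ x)) ∎
        where
          open ≡-Reasoning
          u = insertAt params hole (lookup v j)

    one-by-one : ∀ {n} {θ : Rel ∣ A ∣ ℓ} → IsEquivalence θ → (g : Vec ∣ A ∣ n → ∣ A ∣) →
      (∀ v j x y → θ x y → θ (g (v [ j ]≔ x)) (g (v [ j ]≔ y))) →
      ∀ {v w} → Pointwise θ {n} {n} v w → θ (g v) (g w)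
    one-by-one eq g step [] = IsEquivalence.refl eq
    one-by-one eq g step (_∷_ {x = x} {y} {xs} p ps) =
      IsEquivalence.trans eq (step (x ∷ xs) zero x y p)
        (one-by-one eq (g ∘ (y ∷_)) (λ v j → step (y ∷ v) (suc j)) ps)

    module _ {θ : Rel ∣ A ∣ ℓ} (θ-cong : IsCongruence A θ) where
      open IsCongruence θ-cong
      private module Eq = IsEquivalence isEquivalence

      mutual
        eval-θ : ∀ {m} (t : Term Ω m) {ρ ρ′} → (∀ i → θ (lookup ρ i) (lookup ρ′ i)) →
                 θ (eval A t ρ) (eval A t ρ′)
        eval-θ (var i)       p = p i
        eval-θ (op {n} ω ts) p = compatible n ω (evalVec-θ ts p)

        evalVec-θ : ∀ {m n} (ts : Vec (Term Ω m) n) {ρ ρ′} →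
                    (∀ i → θ (lookup ρ i) (lookup ρ′ i)) →
                    Pointwise θ (evalVec A ts ρ) (evalVec A ts ρ′)
        evalVec-θ []       p = []
        evalVec-θ (t ∷ ts) p = eval-θ t p ∷ evalVec-θ ts p

      insertAt-θ : ∀ {n} (v : Vec ∣ A ∣ n) i {a b} → θ a b →
                   ∀ j → θ (lookup (insertAt v i a) j) (lookup (insertAt v i b) j)
      insertAt-θ v       zero    p zero    = p
      insertAt-θ v       zero    p (suc j) = Eq.refl
      insertAt-θ (_ ∷ v) (suc i) p zero    = Eq.refl
      insertAt-θ (_ ∷ v) (suc i) p (suc j) = insertAt-θ v i p j

      translate-θ : (f : Translation A) → ∀ {a b} → θ a b → θ (⟦ f ⟧ a) (⟦ f ⟧ b)
      translate-θ f p = eval-θ term (insertAt-θ params hole p)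
        where open Translation f

      saturates⇒respects : ∀ {L} → Saturates θ L → ∀ {a b} → θ a b → a ∈ L → b ∈ L
      saturates⇒respects (S , L⊆ , ⊆L) p a∈L =
        let s , q = L⊆ a∈L in ⊆L (s , Eq.trans q p)

module _ {ℓ : Level} {Ω : Signature ℓ} (A : TopAlgebra Ω) (L : Pred ∣ A ∣ ℓ) where
  open Plug {Ω = Ω}
  open Equivalence

  private
    ~ : Rel ∣ A ∣ ℓ
    ~ = translationRelation A L

    ~-equiv : IsEquivalence ~
    ~-equiv = record
      { refl  = λ f → mk⇔ id id
      ; sym   = λ p f → mk⇔ (from (p f)) (to (p f))
      ; trans = λ p q f → mk⇔ (to (q f) ∘ to (p f)) (from (p f) ∘ from (q f))
      }

    ~-step : ∀ n ω v j x y → ~ x y → ~ (E A n ω (v [ j ]≔ x)) (E A n ω (v [ j ]≔ y))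
    ~-step n ω v j x y p f =
      subst₂ (λ a b → (a ∈ L) ⇔ (b ∈ L))
        (composite-eval A f ω v j x) (composite-eval A f ω v j y)
        (p (composite A f ω v j))

    identity : Translation A
    identity = record { m = 0 ; term = var zero ; hole = zero ; once = refl ; params = [] }

  translationRelation-isLargest : IsLargestSaturatingCongruence A L (translationRelation A L)
  translationRelation-isLargest = record
    { isCongruence = record
        { isEquivalence = ~-equiv
        ; compatible    = λ n ω → one-by-one A ~-equiv (E A n ω) (~-step n ω)
        }
    ; saturates = L , (λ {a} a∈L → (a , a∈L) , IsEquivalence.refl ~-equiv {a})
                    , (λ ((s , s∈L) , p) → to (p identity) s∈L)
    ; largest = λ θ-cong sat p f → mk⇔
        (saturates⇒respects A θ-cong sat (translate-θ A θ-cong f p))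
        (saturates⇒respects A θ-cong sat
          (translate-θ A θ-cong f (IsEquivalence.sym (IsCongruence.isEquivalence θ-cong) p)))
    }

  -- The type pins this down, up to logical equivalence, as the largest congruence
  -- saturating L; translations only provide a definition in the same universe.
  syntacticCongruence : Σ (Rel ∣ A ∣ ℓ) (IsLargestSaturatingCongruence A L)
  syntacticCongruence = translationRelation A L , translationRelation-isLargest

  σ : Rel ∣ A ∣ ℓ
  σ = proj₁ syntacticCongruence

{-# OPTIONS --safe #-}
-- Call a congruence open if its classes are open.  By compactness an open
-- congruence has finitely many classes, so its quotient is a finite discrete
-- algebra; conversely the kernel of a continuous homomorphism into a finite
-- discrete algebra is open.
--
-- If A is profinite and L is clopen, two compactness arguments (first over the
-- points outside L, for a fixed point of L, then over the points of L)
-- intersect finitely many such kernels to an open congruence Θ that saturates L.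
-- As Θ ⊆ σ_L, both σ_L and its complement are unions of boxes of Θ-classes.
-- If all σ_L are clopen, separate a ≠ b by a clopen L; then σ_L is an open
-- congruence whose finite quotient separates a from b.
module Submission where

open import Defs
open import Axiom.DoubleNegationElimination using (em⇒dne)
open import Axiom.ExcludedMiddle using (ExcludedMiddle)
open import Data.Fin using (Fin; zero; suc)
open import Data.List using (List; []; _∷_; lookup; length; deduplicate)
open import Data.List.Membership.Propositional using (find) renaming (_∈_ to _∈ₗ_)
open import Data.List.Membership.Propositional.Properties using (∈-lookup)
open import Data.List.Relation.Unary.All as All using ()
open import Data.List.Relation.Unary.AllPairs using (AllPairs; _∷_)
open import Data.List.Relation.Unary.Any using (Any; here; there; index)
open import Data.List.Relation.Unary.Any.Properties using (lookup-index; deduplicate⁺)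
open import Data.List.Relation.Unary.Unique.DecSetoid.Properties using (deduplicate-!)
open import Data.Maybe using (Maybe; just; nothing)
open import Data.Product using (Σ-syntax; ∃; _×_; _,_; proj₁; proj₂; uncurry)
open import Data.Unit.Polymorphic using (⊤; tt)
open import Data.Vec as Vec using (Vec; []; _∷_)
open import Data.Vec.Relation.Binary.Pointwise.Inductive as Pointwise using (Pointwise; []; _∷_; Pointwise-≡⇒≡)
open import Function using (_⇔_; mk⇔; mk↔ₛ′; id; _∘_)
open import Level using (Level; Lift; lift; lower) renaming (suc to lsuc)
open import Relation.Binary using (Rel; IsEquivalence; Symmetric; DecSetoid; _⇒_)
open import Relation.Binary.PropositionalEquality using (_≡_; _≢_; refl; sym; trans; cong; subst)
open import Relation.Nullary using (¬_; yes; no; contradiction)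
open import Relation.Unary using (Pred; _∈_; _∉_; ∁; _⊆_; ⋃)
open TopAlgebra using (space; ∣_∣)

-- Preliminaries on lists and topological spaces.

lookup-injective : ∀ {a r} {X : Set a} {_≈_ : Rel X r} → Symmetric _≈_ →
  ∀ {xs} → AllPairs (λ x y → ¬ x ≈ y) xs →
  ∀ i j → lookup xs i ≈ lookup xs j → i ≡ j
lookup-injective s (x≉ ∷ xs!) zero    zero    p = refl
lookup-injective s (x≉ ∷ xs!) zero    (suc j) p = contradiction p (All.lookup x≉ (∈-lookup j))
-- `AllPairs` relates earlier entries to later ones only, so the reversed order of indices calls for
-- symmetry.
lookup-injective s (x≉ ∷ xs!) (suc i) zero    p = contradiction (s p) (All.lookup x≉ (∈-lookup i))
lookup-injective s (x≉ ∷ xs!) (suc i) (suc j) p = cong suc (lookup-injective s xs! i j p)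

module _ {ℓ : Level} where
  open Space using (Carrier; IsOpen; open-≐; open-⋃)

  locally-open⇒open : (X : Space ℓ) (W : Pred (Carrier X) ℓ) →
    (∀ x → x ∈ W → Σ[ V ∈ Pred (Carrier X) ℓ ] IsOpen X V × x ∈ V × V ⊆ W) → IsOpen X W
  locally-open⇒open X W nbhd = open-≐ X
    ( (λ ((x , x∈W) , y∈V) → proj₂ (proj₂ (proj₂ (nbhd x x∈W))) y∈V)
    , (λ {x} x∈W → (x , x∈W) , proj₁ (proj₂ (proj₂ (nbhd x x∈W)))) )
    (open-⋃ X (∃ W) (λ (x , x∈W) → proj₁ (nbhd x x∈W))
      (λ (x , x∈W) → proj₁ (proj₂ (nbhd x x∈W))))

  discrete : Set ℓ → Space ℓ
  discrete S = record
    { Carrier = S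
    ; IsOpen  = λ _ → ⊤
    ; open-≐  = λ _ _ → tt
    ; open-U  = tt
    ; open-∩  = λ _ _ → tt
    ; open-⋃  = λ _ _ _ → tt
    }

  ^ₛ-discrete : ∀ {X : Space ℓ} → IsDiscrete X → ∀ n → IsDiscrete (X ^ₛ n)
  ^ₛ-discrete disc n W v v∈W =
    (λ i → Vec.lookup v i ≡_) , (λ i → disc _) , (λ i → refl) ,
    λ w v≗w → subst W (Plug.vec-ext {Ω = λ _ → discrete ⊤} v≗w) v∈W

-- Open congruences.

module _ {ℓ : Level} {Ω : Signature ℓ} (A : TopAlgebra Ω) where
  open TopAlgebra A using (E; E-cont)
  private module A = Space (space A)

  -- Having open classes is equivalent to having an open graph in the square, by
  -- `open-graph⇒openCongruence` and `respects⇒open₂`; classes are what covers are made of.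
  record OpenCongruence : Set (lsuc ℓ) where
    field
      rel          : Rel ∣ A ∣ ℓ
      isCongruence : IsCongruence A rel
      class-open   : ∀ x → A.IsOpen (rel x)

    open IsCongruence isCongruence public
    open IsEquivalence isEquivalence public
      renaming (refl to ≈-refl; sym to ≈-sym; trans to ≈-trans)

  open OpenCongruence using (rel)

  total : OpenCongruence
  total = record
    { rel          = λ _ _ → ⊤
    ; isCongruence = record
        { isEquivalence = record { refl = tt ; sym = λ _ → tt ; trans = λ _ _ → tt }
        ; compatible    = λ _ _ _ → tt
        }
    ; class-open   = λ _ → A.open-U
    }

  _⊓_ : OpenCongruence → OpenCongruence → OpenCongruence
  θ ⊓ φ = record
    { rel          = λ x y → rel θ x y × rel φ x y
    ; isCongruence = record
        { isEquivalence = record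
            { refl  = θ.≈-refl , φ.≈-refl
            ; sym   = λ (p , q) → θ.≈-sym p , φ.≈-sym q
            ; trans = λ (p , q) (p′ , q′) → θ.≈-trans p p′ , φ.≈-trans q q′
            }
        ; compatible    = λ n ω ps →
            θ.compatible n ω (Pointwise.map proj₁ ps) , φ.compatible n ω (Pointwise.map proj₂ ps)
        }
    ; class-open   = λ x → A.open-∩ (θ.class-open x) (φ.class-open x)
    }
    where
      module θ = OpenCongruence θ
      module φ = OpenCongruence φ

  ⋀ : {I : Set ℓ} → (I → OpenCongruence) → List I → OpenCongruence
  ⋀ θ []       = total
  ⋀ θ (i ∷ is) = θ i ⊓ ⋀ θ is

  ⋀-lower : ∀ {I : Set ℓ} (θ : I → OpenCongruence) {i is} → i ∈ₗ is → rel (⋀ θ is) ⇒ rel (θ i)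
  ⋀-lower θ (here refl) (p , _) = p
  ⋀-lower θ (there i∈)  (_ , q) = ⋀-lower θ i∈ q

  kernel : (F : TopAlgebra Ω) → IsDiscrete (space F) → (h : ∣ A ∣ → ∣ F ∣) →
    IsHomomorphism A F h → Continuous (space A) (space F) h → OpenCongruence
  kernel F disc h hom cont = record
    { rel          = λ x y → h x ≡ h y
    ; isCongruence = record
        { isEquivalence = record { refl = refl ; sym = sym ; trans = trans }
        ; compatible    = λ n ω {v} {w} ps →
            trans (hom n ω v)
              (trans (cong (TopAlgebra.E F n ω) (Pointwise-≡⇒≡ (Pointwise.map⁺ id ps)))
                (sym (hom n ω w)))
        }
    -- The class of `x` is the preimage of the singleton of `h x`.
    ; class-open   = λ x → cont (h x ≡_) (disc _)
    }

  module _ (θ : OpenCongruence) where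
    open OpenCongruence θ using (class-open; ≈-refl)

    respects⇒open : (P : Pred ∣ A ∣ ℓ) → (∀ {x y} → rel θ x y → x ∈ P → y ∈ P) → A.IsOpen P
    respects⇒open P resp = locally-open⇒open (space A) P
      λ x x∈P → rel θ x , class-open x , ≈-refl , λ p → resp p x∈P

    -- With each of its points `P` contains the box of the two classes. Complements of invariant
    -- sets are invariant, so closedness can be had in the same way.
    respects⇒open₂ : (P : Pred (∣ A ∣ × ∣ A ∣) ℓ) →
      (∀ {x y x′ y′} → rel θ x x′ → rel θ y y′ → (x , y) ∈ P → (x′ , y′) ∈ P) →
      Space.IsOpen (space A ×ₛ space A) P
    respects⇒open₂ P resp x y xy∈P =
      rel θ x , rel θ y , class-open x , class-open y , ≈-refl , ≈-refl ,
      λ _ _ p q → resp p q xy∈P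

  -- A class is a slice of the graph: the second side of a box around `(x , y)` inside the graph is
  -- a neighbourhood of `y` in the class of `x`.
  open-graph⇒openCongruence : ∀ {θ} → IsCongruence A θ →
    Space.IsOpen (space A ×ₛ space A) (uncurry θ) → OpenCongruence
  open-graph⇒openCongruence {θ} θ-cong o = record
    { rel          = θ
    ; isCongruence = θ-cong
    ; class-open   = λ x → locally-open⇒open (space A) (θ x) λ y p →
        let _ , V , _ , oV , x∈ , y∈V , sub = o x y p in V , oV , y∈V , λ z∈V → sub x _ x∈ z∈V
    }

  ⊆σ⇒clopen : ∀ L (θ : OpenCongruence) → rel θ ⇒ σ A L →
    IsClopen (space A ×ₛ space A) (uncurry (σ A L))
  ⊆σ⇒clopen L θ θ⊆σ =
    respects⇒open₂ θ _ (λ p q r → σ-trans (σ-sym (θ⊆σ p)) (σ-trans r (θ⊆σ q))) ,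
    respects⇒open₂ θ _ (λ p q ¬r r → ¬r (σ-trans (θ⊆σ p) (σ-trans r (σ-sym (θ⊆σ q)))))
    where
      open IsLargestSaturatingCongruence (translationRelation-isLargest A L)
      open IsEquivalence (IsCongruence.isEquivalence isCongruence)
        renaming (sym to σ-sym; trans to σ-trans)

  -- Finite meets by compactness.

  module _ (em : ∀ {a} → ExcludedMiddle a) (compact : HasFiniteSubcovers (space A)) where

    -- The classes b/θ b with b ∈ K, together with ∁ K, cover A.
    finite-meet : ∀ {K} → IsClosed (space A) K → (θ : ∃ K → OpenCongruence) →
      Σ[ Θ ∈ OpenCongruence ] ∀ {x} → x ∈ K →
        Σ[ b ∈ ∃ K ] rel (θ b) (proj₁ b) x × rel Θ ⇒ rel (θ b)
    finite-meet {K} K-closed θ = ⋀ θ′ is , λ {x} x∈K → pick x∈K (find (is-cover x))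
      where
        θ′ : Maybe (∃ K) → OpenCongruence
        -- `nothing` is the index of `∁ K`, which must not constrain the meet.
        θ′ nothing  = total
        θ′ (just b) = θ b

        V : Maybe (∃ K) → Pred ∣ A ∣ ℓ
        V nothing  = ∁ K
        V (just b) = rel (θ b) (proj₁ b)

        V-open : ∀ i → A.IsOpen (V i)
        V-open nothing  = K-closed
        V-open (just b) = OpenCongruence.class-open (θ b) (proj₁ b)

        V-cover : ∀ x → x ∈ ⋃ _ V
        V-cover x with em {P = x ∈ K}
        ... | yes x∈K = just (x , x∈K) , OpenCongruence.≈-refl (θ (x , x∈K))
        ... | no  x∉K = nothing , x∉K

        subcover : Σ[ is ∈ List (Maybe (∃ K)) ] (∀ x → Any (λ i → x ∈ V i) is)
        subcover = compact _ V V-open V-cover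

        is : List (Maybe (∃ K))
        is = proj₁ subcover

        is-cover : ∀ x → Any (λ i → x ∈ V i) is
        is-cover = proj₂ subcover

        pick : ∀ {x} → x ∈ K → Σ[ i ∈ Maybe (∃ K) ] i ∈ₗ is × x ∈ V i →
          Σ[ b ∈ ∃ K ] rel (θ b) (proj₁ b) x × rel (⋀ θ′ is) ⇒ rel (θ b)
        pick x∈K (nothing , _  , x∉K) = contradiction x∈K x∉K
        pick x∈K (just b  , i∈ , p)   = b , p , ⋀-lower θ′ i∈

    -- Clopen syntactic congruences from separation.

    module _ (separate : ∀ a b → a ≢ b → Σ[ θ ∈ OpenCongruence ] ¬ rel θ a b)
             {L : Pred ∣ A ∣ ℓ} (L-clopen : IsClopen (space A) L) where

      -- Each `c` outside `L` has a congruence separating it from `a`. A point `x` of the class of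
      -- `a` outside `L` would be related to such a `c` by the congruence chosen for `c`, and so
      -- would `a`.
      class-inside : ∀ {a} → a ∈ L → Σ[ Θ ∈ OpenCongruence ] rel Θ a ⊆ L
      class-inside {a} a∈L = Θ , λ {x} aΘx → em⇒dne em λ x∉L →
        let b@(c , c∉L) , cθx , Θ⊆θ = Θ-prop x∉L
            open OpenCongruence (proj₁ (sep b)) using (≈-sym; ≈-trans)
        in proj₂ (sep b) (≈-trans (Θ⊆θ aΘx) (≈-sym cθx))
        where
          sep : (b : ∃ (∁ L)) → Σ[ θ ∈ OpenCongruence ] ¬ rel θ a (proj₁ b)
          sep (b , b∉L) = separate a b λ a≡b → b∉L (subst L a≡b a∈L)

          meet = finite-meet
            -- `∁ L` is closed because its complement is classically `L`, an open set.
            (A.open-≐ ((λ x∈L x∉L → x∉L x∈L) , em⇒dne em) (proj₁ L-clopen))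
            (proj₁ ∘ sep)
          Θ = proj₁ meet
          Θ-prop = proj₂ meet

      saturating : Σ[ Θ ∈ OpenCongruence ] (∀ {x y} → rel Θ x y → x ∈ L → y ∈ L)
      saturating =
        let Θ , Θ-prop = finite-meet (proj₂ L-clopen) (λ (a , a∈L) → proj₁ (class-inside a∈L))
        in Θ , λ xΘy x∈L →
          let (a , a∈L) , aθx , Θ⊆θ = Θ-prop x∈L
              θ , θa⊆L = class-inside a∈L
          in θa⊆L (OpenCongruence.≈-trans θ aθx (Θ⊆θ xΘy))

      σ-clopen : IsClopen (space A ×ₛ space A) (uncurry (σ A L))
      σ-clopen = ⊆σ⇒clopen L Θ (largest (OpenCongruence.isCongruence Θ)
        -- All points of `L` serve as representatives of the classes making up `L`.
        (L , (λ {x} x∈L → (x , x∈L) , OpenCongruence.≈-refl Θ)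
           , (λ ((x , x∈L) , xΘy) → Θ-resp xΘy x∈L)))
        where
          open IsLargestSaturatingCongruence (translationRelation-isLargest A L) using (largest)
          Θ = proj₁ saturating
          Θ-resp = proj₂ saturating

    -- The finite discrete quotient by an open congruence.

    module FiniteQuotient (θ : OpenCongruence) where
      open OpenCongruence θ hiding (rel)

      decSetoid : DecSetoid ℓ ℓ
      decSetoid = record
        { Carrier = ∣ A ∣
        ; _≈_ = rel θ
        ; isDecEquivalence = record { isEquivalence = isEquivalence ; _≟_ = λ _ _ → em }
        }
      open DecSetoid decSetoid using (_≟_)

      subcover : Σ[ xs ∈ List ∣ A ∣ ] (∀ a → Any (λ x → rel θ x a) xs)
      subcover = compact ∣ A ∣ (rel θ) class-open (λ a → a , ≈-refl)

      -- A subcover may list several points of one class. Deduplication leaves one representative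
      -- per class, so the index found for a point depends on its class only.
      reps : List ∣ A ∣
      reps = deduplicate _≟_ (proj₁ subcover)

      Classes : Set ℓ
      Classes = Lift ℓ (Fin (length reps))

      covered : ∀ a → Any (λ x → rel θ x a) reps
      covered a = deduplicate⁺ _≟_ (λ p q → ≈-trans p q) (proj₂ subcover a)

      class : ∣ A ∣ → Classes
      class a = lift (index (covered a))

      rep : Classes → ∣ A ∣
      rep c = lookup reps (lower c)

      rep-class : ∀ a → rel θ (rep (class a)) a
      rep-class a = lookup-index (covered a)

      class-cong : ∀ {a b} → rel θ a b → class a ≡ class b
      class-cong {a} {b} p = cong lift
        (lookup-injective ≈-sym (deduplicate-! decSetoid (proj₁ subcover)) _ _
          (≈-trans (rep-class a) (≈-trans p (≈-sym (rep-class b)))))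

      class-injective : ∀ {a b} → class a ≡ class b → rel θ a b
      class-injective {a} {b} p =
        ≈-trans (≈-sym (rep-class a)) (subst (λ c → rel θ (rep c) b) (sym p) (rep-class b))

      class-continuous : Continuous (space A) (discrete Classes) class
      class-continuous V _ = respects⇒open θ _ λ p → subst V (class-cong p)

      quotient : TopAlgebra Ω
      quotient = record
        { space  = discrete Classes
        ; E      = λ n ω v → class (E n ω (Vec.map rep v))
        ; E-cont = λ n V oV ω v p →
            -- Continuity of the operation of `A` at the representatives of `v` yields a
            -- neighbourhood of `ω`; in the tuples of classes the singleton of `v` is open and
            -- completes the box.
            let V₁ , _ , o₁ , _ , ω∈ , v∈ , sub =
                  E-cont n _ (class-continuous V oV) ω (Vec.map rep v) p
            in V₁ , (v ≡_) , o₁ , ^ₛ-discrete {X = discrete Classes} (λ _ → tt) n (v ≡_) ,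
               ω∈ , refl , λ { ω′ _ ω′∈ refl → sub ω′ (Vec.map rep v) ω′∈ v∈ }
        }

      quotient-finite : IsFinite Classes
      quotient-finite = length reps , mk↔ₛ′ lower lift (λ _ → refl) (λ _ → refl)

      class-hom : IsHomomorphism A quotient class
      class-hom n ω v = class-cong (compatible n ω (rep-class-vec v))
        where
          rep-class-vec : ∀ {n} (v : Vec ∣ A ∣ n) →
            Pointwise (rel θ) v (Vec.map rep (Vec.map class v))
          rep-class-vec []      = []
          rep-class-vec (a ∷ v) = ≈-sym (rep-class a) ∷ rep-class-vec v

  -- Separation of points, and the equivalence.

  profinite⇒separates : IsProfinite A → ∀ a b → a ≢ b → Σ[ θ ∈ OpenCongruence ] ¬ rel θ a b
  profinite⇒separates (_ , residually-finite) a b a≢b =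
    let F , _ , disc , h , hom , cont , ha≢hb = residually-finite a b a≢b
    in kernel F disc h hom cont , ha≢hb

  separating-clopen : IsStone (space A) → ∀ a b → a ≢ b →
    Σ[ L ∈ Pred ∣ A ∣ ℓ ] IsClopen (space A) L × a ∈ L × b ∉ L
  separating-clopen ((_ , hausdorff) , zero-dim) a b a≢b =
    let V , _ , oV , _ , a∈V , b∈W , disjoint = hausdorff a b a≢b
        L , L-clopen , a∈L , L⊆V = zero-dim V oV a a∈V
    in L , L-clopen , a∈L , λ b∈L → disjoint b (L⊆V b∈L , b∈W)

theorem2p7 : (∀ {a} → ExcludedMiddle a) →
    ∀ {ℓ : Level} (Ω : Signature ℓ) (A : TopAlgebra Ω) → IsStone (space A) →
    IsProfinite A ⇔ ((L : Pred ∣ A ∣ ℓ) → IsClopen (space A) L → IsClopen (space A ×ₛ space A) (uncurry (σ A L)))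
theorem2p7 em Ω A stone@(compact , _) = mk⇔
  (λ profinite L → σ-clopen A em (proj₁ compact) (profinite⇒separates A profinite) {L})
  (λ clopen → compact , λ a b a≢b →
    let L , L-clopen , a∈L , b∉L = separating-clopen A stone a b a≢b
        open IsLargestSaturatingCongruence (translationRelation-isLargest A L)
        open FiniteQuotient A em (proj₁ compact)
          (open-graph⇒openCongruence A {σ A L} isCongruence (proj₁ (clopen L L-clopen)))
    in quotient , quotient-finite , (λ _ → tt) , class , class-hom , class-continuous ,
       -- Equal images would make `a` and `b` congruent, and saturation would then carry `b` into
       -- `L`.
       λ p → b∉L (Plug.saturates⇒respects A isCongruence saturates (class-injective p) a∈L))
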